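{- Let $k\in\mathbb{Z}$, let $n\ge 1$ be an integer, and let $\lambda\in\mathbb{C}$ be nonzero. Then $$\beta_{n,\lambda}^{(k)}-\beta_{n,\lambda}^{(k)}(-1)=\sum_{l=1}^{n}\sum_{m=0}^{l-1}\frac{m!\,(-1)^{l-m-1}\lambda^{n-l}S_{2}(l,m+1)S_{1}(n,l)}{(m+1)^{k-1}}.$$
   Context: For $k\in\mathbb{Z}$, the polylogarithm is the power series $\mathrm{Li}_k(u)=\sum_{n=1}^{\infty}\frac{u^n}{n^k}$. For nonzero $\lambda$, the fully degenerate poly-Bernoulli polynomials $\beta_{n,\lambda}^{(k)}(x)$ are defined by the generating function (identity of formal power series in $t$) $$\frac{\mathrm{Li}_{k}\left(1-(1+\lambda t)^{ -1/\lambda}\right)}{1-(1+\lambda t)^{ -1/\lambda}}(1+\lambda t)^{x/\lambda}=\sum_{n=0}^{\infty}\beta_{n,\lambda}^{(k)}(x)\frac{t^{n}}{n!},$$ where $(1+\lambda t)^{a}=\sum_{j\ge0}(a)_j\lambda^j\frac{t^j}{j!}$, $(a)_j=a(a-1)\cdots(a-j+1)$ with $(a)_0=1$, and $\mathrm{Li}_k(u)/u$ denotes the series $\sum_{m\ge 0}u^m/(m+1)^k$. The fully degenerate poly-Bernoulli numbers are $\beta_{n,\lambda}^{(k)}=\beta_{n,\lambda}^{(k)}(0)$. $S_1(n,l)$ denotes the (signed) Stirling numbers of the first kind, $(x)_n=\sum_{l=0}^n S_1(n,l)x^l$, and $S_2(n,l)$ the Stirling numbers of the second kind, $\frac{(e^t-1)^l}{l!}=\sum_{n\ge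 l}S_2(n,l)\frac{t^n}{n!}$. -}

module Defs where

open import Algebra.Apartness.Bundles using (HeytingField; HeytingCommutativeRing)
open import Algebra.Bundles using (CommutativeRing)
open import Algebra.Bundles.Raw using (RawRing)
import Algebra.Definitions.RawSemiring as RawSemiringDefinitions
import Algebra.Properties.Semiring.Sum as Summation
open import Data.Fin.Base using (toℕ)
open import Data.Integer.Base as ℤ using (ℤ; +_; -[1+_])
open import Data.Nat.Base using (ℕ; zero; suc; NonZero; _∸_; _!)
open import Data.Nat.Properties using (_!≢0)
open import Data.Product.Base using (proj₁)

commutativeRing : ∀ {c ℓ₁ ℓ₂} → HeytingField c ℓ₁ ℓ₂ → CommutativeRing c ℓ₁
commutativeRing K =
  HeytingCommutativeRing.commutativeRing (HeytingField.heytingCommutativeRing K)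

module _ {c ℓ} (R : RawRing c ℓ) where
  open RawRing R
  open RawSemiringDefinitions rawSemiring using (_×_)

  fallingFactorial : Carrier → ℕ → Carrier
  fallingFactorial a zero    = 1#
  fallingFactorial a (suc j) = fallingFactorial a j * (a + - (j × 1#))

CharacteristicZero : ∀ {c ℓ₁ ℓ₂} → HeytingField c ℓ₁ ℓ₂ → Set ℓ₂
CharacteristicZero K = ∀ n → .{{NonZero n}} → (n × 1#) # 0#
  where
  open HeytingField K using (1#; 0#; _#_)
  open CommutativeRing (commutativeRing K) using (rawRing)
  open RawSemiringDefinitions (RawRing.rawSemiring rawRing) using (_×_)

module CharZeroField {c ℓ₁ ℓ₂} (K : HeytingField c ℓ₁ ℓ₂) (char0 : CharacteristicZero K) where
  open HeytingField K
  open CommutativeRing (commutativeRing K) using (rawRing; semiring)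
  open RawSemiringDefinitions (RawRing.rawSemiring rawRing) public using (_×_; _^_)

  -- The body of ∑[ i < n ] binds tighter than _*_, so compound bodies are
  -- parenthesised throughout.
  open Summation semiring public using (sum; sum-syntax; sum⁺-syntax)

  fromℕ : ℕ → Carrier
  fromℕ n = n × 1#

  -- #⇒invertible inverts x - 0#, which is ≈ x.
  inverse : (x : Carrier) → x # 0# → Carrier
  inverse x x#0 = proj₁ (#⇒invertible x#0)

  factorialInverse : ℕ → Carrier
  factorialInverse n = inverse (fromℕ (n !)) (char0 (n !) {{n !≢0}})

  power : (x : Carrier) → x # 0# → ℤ → Carrier
  power x x#0 (+ n)    = x ^ n
  power x x#0 -[1+ n ] = inverse x x#0 ^ suc n

  -- 1 / nᵏ, as n⁻ᵏ
  powerInverse : (n : ℕ) → .{{NonZero n}} → ℤ → Carrier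
  powerInverse n k = power (fromℕ n) (char0 n) (ℤ.- k)

  -- Formal power series, given by f n = [tⁿ] f.
  Series : Set c
  Series = ℕ → Carrier

  const : Carrier → Series
  const a zero    = a
  const a (suc n) = 0#

  var : Series
  var zero          = 0#
  var (suc zero)    = 1#
  var (suc (suc n)) = 0#

  seriesRawRing : RawRing c ℓ₁
  seriesRawRing = record
    { Carrier = Series
    ; _≈_     = λ f g → ∀ n → f n ≈ g n
    ; _+_     = λ f g n → f n + g n
    ; _*_     = λ f g n → ∑[ i ≤ n ] (f (toℕ i) * g (n ∸ toℕ i))
    ; -_      = λ f n → - f n
    ; 0#      = const 0#
    ; 1#      = const 1#
    }

  module S where
    open RawRing seriesRawRing public
    open RawSemiringDefinitions rawSemiring public using (_^_)

  -- Σₘ aₘ uᵐ for u with zero constant term: as tᵐ divides uᵐ, only the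
  -- terms with m ≤ n contribute to the coefficient of tⁿ.
  substitute : Series → Series → Series
  substitute a u n = ∑[ m ≤ n ] (a (toℕ m) * (u S.^ toℕ m) n)

  -- (1 + ƛ t)ᵃ
  binomialSeries : Carrier → Carrier → Series
  binomialSeries ƛ a j = fallingFactorial rawRing a j * ƛ ^ j * factorialInverse j

  exp : Series
  exp n = factorialInverse n

  Li : ℤ → Series
  Li k zero    = 0#
  Li k (suc m) = powerInverse (suc m) k

  -- Li k (u) / u as a series in u
  Li/u : ℤ → Series
  Li/u k m = Li k (suc m)

  -- The coefficient of xˡ in x (x - 1) ⋯ (x - n + 1), polynomials in x being
  -- series with finitely many nonzero coefficients.
  S₁ : ℕ → ℕ → Carrier
  S₁ n l = fallingFactorial seriesRawRing var n l

  -- (eᵗ - 1)ˡ / l! = Σₙ S₂ n l tⁿ / n!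
  S₂ : ℕ → ℕ → Carrier
  S₂ n l = fromℕ (n !) * (((exp S.+ (S.- S.1#)) S.^ l) n * factorialInverse l)

  module _ (k : ℤ) (ƛ : Carrier) (ƛ#0 : ƛ # 0#) where
    private
      1/ƛ : Carrier
      1/ƛ = inverse ƛ ƛ#0

    -- Σₙ βₙ(x) tⁿ / n!
    polyBernoulliSeries : Carrier → Series
    polyBernoulliSeries x =
      substitute (Li/u k) (S.1# S.+ (S.- binomialSeries ƛ (- 1/ƛ)))
        S.* binomialSeries ƛ (x * 1/ƛ)

    polyBernoulliPolynomial : ℕ → Carrier → Carrier
    polyBernoulliPolynomial n x = fromℕ (n !) * polyBernoulliSeries x n

    polyBernoulliNumber : ℕ → Carrier
    polyBernoulliNumber n = polyBernoulliPolynomial n 0#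

{-# OPTIONS --safe #-}
module Submission where

open import Defs
open import Algebra.Apartness.Bundles using (HeytingField)
open import Algebra.Bundles using (CommutativeRing)
import Algebra.Definitions.RawSemiring as RawSemiringDefinitions
open import Data.Fin.Base using (Fin; zero; suc; toℕ; opposite)
open import Data.Fin.Permutation using (reverse)
open import Data.Fin.Properties using (opposite-prop; toℕ<n; toℕ≤pred[n])
open import Data.Integer.Base as ℤ using (ℤ; +_; -[1+_])
open import Data.Nat.Base as ℕ using (ℕ; zero; suc; _≤_; _<_; z≤n; s≤s; z<s; _∸_; _!)
open import Data.Nat.Properties as ℕ using (_!≢0)
open import Data.Product.Base using (proj₂)
open import Relation.Nullary.Decidable.Core using (yes; no)
import Relation.Binary.PropositionalEquality.Core as ≡

-- Put u = 1 - (1 + ƛ t)^(-1/ƛ).  The difference of the two generating functions is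
-- (Liₖ(u) / u) (1 - (1 + ƛ t)^(-1/ƛ)) = Liₖ(u) = Σₘ uᵐ⁺¹ / (m + 1)ᵏ, so everything rests on
-- n! [tⁿ] uᵐ = Σₗ ƛⁿ⁻ˡ S₁(n, l) (-1)ˡ⁺ᵐ l! [tˡ] (eᵗ - 1)ᵐ.  For the derivation
-- δ μ = (1 + μ t) d/dt one has δ ƛ u = 1 - u and δ 0 (eᵗ - 1) = 1 + (eᵗ - 1), and the power rule
-- then makes both sides satisfy the same recurrence in n.
module PolyBernoulli {c ℓ₁ ℓ₂} (K : HeytingField c ℓ₁ ℓ₂) (char0 : CharacteristicZero K) where
  open HeytingField K using (_#_)
  open CharZeroField K char0
  open CommutativeRing (commutativeRing K)
  open import Algebra.Properties.Monoid.Mult +-monoid using (×-homo-+)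
  open import Algebra.Properties.Ring ring
    using (-1*x≈-x; -0#≈0#; -‿distribʳ-*; -‿involutive; +-cancelʳ; -‿+-comm; x[y-z]≈xy-xz)
  open import Algebra.Properties.Semiring.Mult semiring using (×1-homo-*)
  open import Algebra.Properties.Semiring.Sum semiring
    using (sum-cong-≋; sum-replicate-zero; *-distribˡ-sum; ∑-distrib-+; ∑-comm; ∑-permute)
  open import Algebra.Solver.Ring.NaturalCoefficients.Default commutativeSemiring
    using (solve; _:=_; _:*_; _:+_)
  open import Relation.Binary.Reasoning.Setoid setoid

  -- Finite sums, inverse factorials and powers in the field.

  x≈0⇒x*y≈0 : ∀ {x} y → x ≈ 0# → x * y ≈ 0#
  x≈0⇒x*y≈0 y x≈0 = trans (*-congʳ x≈0) (zeroˡ y)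

  y≈0⇒x*y≈0 : ∀ x {y} → y ≈ 0# → x * y ≈ 0#
  y≈0⇒x*y≈0 x y≈0 = trans (*-congˡ y≈0) (zeroʳ x)

  x*y≈1⇒x*[y*z]≈z : ∀ {x y} z → x * y ≈ 1# → x * (y * z) ≈ z
  x*y≈1⇒x*[y*z]≈z {x} {y} z xy≈1 = trans (sym (*-assoc x y z)) (trans (*-congʳ xy≈1) (*-identityˡ z))

  sum-zero : ∀ {n} (f : Fin n → Carrier) → (∀ i → f i ≈ 0#) → sum f ≈ 0#
  sum-zero {n} f f≈0 = trans (sum-cong-≋ f≈0) (sum-replicate-zero n)

  -- `f` is indexed by ℕ, not by `Fin`, so that one summand can be read at both lengths; every later
  -- change of an upper bound is an instance.
  sum-extend : ∀ {m n} (f : ℕ → Carrier) → m ≤ n → (∀ i → m ≤ i → f i ≈ 0#) →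
               ∑[ i < m ] f (toℕ i) ≈ ∑[ i < n ] f (toℕ i)
  sum-extend {n = n} f z≤n       f≈0 = sym (sum-zero {n} (λ i → f (toℕ i)) λ i → f≈0 (toℕ i) z≤n)
  sum-extend         f (s≤s m≤n) f≈0 = +-congˡ (sum-extend (λ i → f (suc i)) m≤n λ i m≤i → f≈0 (suc i) (s≤s m≤i))

  fromℕ-suc! : ∀ n → fromℕ (suc n !) ≈ fromℕ (suc n) * fromℕ (n !)
  fromℕ-suc! n = ×1-homo-* (suc n) (n !)

  inverse-inverseʳ : ∀ x (x#0 : x # 0#) → x * inverse x x#0 ≈ 1#
  inverse-inverseʳ x x#0 = trans (*-congʳ x≈x-0) (proj₂ (proj₂ (HeytingField.#⇒invertible K x#0)))
    where
    x≈x-0 : x ≈ x - 0#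
    x≈x-0 = sym (trans (+-congˡ -0#≈0#) (+-identityʳ x))

  factorialInverse-inverseʳ : ∀ n → fromℕ (n !) * factorialInverse n ≈ 1#
  factorialInverse-inverseʳ n = inverse-inverseʳ (fromℕ (n !)) (char0 (n !) {{n !≢0}})

  factorialInverse-zero : factorialInverse 0 ≈ 1#
  factorialInverse-zero = begin
    factorialInverse 0              ≈⟨ *-identityˡ _ ⟨
    1# * factorialInverse 0         ≈⟨ *-congʳ (+-identityʳ 1#) ⟨
    fromℕ (0 !) * factorialInverse 0 ≈⟨ factorialInverse-inverseʳ 0 ⟩
    1#                              ∎

  factorialInverse-suc : ∀ n → fromℕ (suc n) * factorialInverse (suc n) ≈ factorialInverse n
  factorialInverse-suc n = begin
    fromℕ (suc n) * factorialInverse (suc n)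
      ≈⟨ x*y≈1⇒x*[y*z]≈z _ (factorialInverse-inverseʳ n) ⟨
    fromℕ (n !) * (factorialInverse n * (fromℕ (suc n) * factorialInverse (suc n)))
      ≈⟨ solve 4 (λ a b c d → a :* (b :* (c :* d)) := ((c :* a) :* d) :* b) refl _ _ _ _ ⟩
    fromℕ (suc n) * fromℕ (n !) * factorialInverse (suc n) * factorialInverse n
      ≈⟨ *-congʳ (*-congʳ (fromℕ-suc! n)) ⟨
    fromℕ (suc n !) * factorialInverse (suc n) * factorialInverse n
      ≈⟨ *-congʳ (factorialInverse-inverseʳ (suc n)) ⟩
    1# * factorialInverse n
      ≈⟨ *-identityˡ _ ⟩
    factorialInverse n ∎

  -- This turns the exponent k of the polylogarithm into the exponent k - 1 of the formula. The
  -- cases follow the sign of the exponent, on which `power` is defined.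
  powerInverse-pred : ∀ n k → powerInverse (suc n) (k ℤ.- + 1) ≈ fromℕ (suc n) * powerInverse (suc n) k
  powerInverse-pred n (+ 0)           = refl
  powerInverse-pred n (+ 1)           = sym (trans (*-congˡ (*-identityʳ _)) (inverse-inverseʳ _ (char0 (suc n))))
  powerInverse-pred n (+ suc (suc j)) = sym (x*y≈1⇒x*[y*z]≈z _ (inverse-inverseʳ _ (char0 (suc n))))
  -- Here k - 1 computes to `-[1+ suc (j + 0) ]`, so only j + 0 = j remains.
  powerInverse-pred n -[1+ j ]        = reflexive (≡.cong (λ i → fromℕ (suc n) ^ suc (suc i)) (ℕ.+-identityʳ j))

  -- The Cauchy product of power series.

  cauchyTerm : Series → Series → ∀ n → Fin (suc n) → Carrier
  cauchyTerm f g n i = f (toℕ i) * g (n ∸ toℕ i)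

  S*-cong : ∀ {f f′ g g′} → f S.≈ f′ → g S.≈ g′ → (f S.* g) S.≈ (f′ S.* g′)
  S*-cong {f} {f′} {g} {g′} f≈f′ g≈g′ n =
    sum-cong-≋ {suc n} {cauchyTerm f g n} {cauchyTerm f′ g′ n}
      λ i → *-cong (f≈f′ (toℕ i)) (g≈g′ (n ∸ toℕ i))

  -- Vanishing is asked only up to index n, because a power of a series without constant term
  -- vanishes only below its order.
  S*-zeroʳ : ∀ f g n → (∀ i → i ≤ n → g i ≈ 0#) → (f S.* g) n ≈ 0#
  S*-zeroʳ f g n g≈0 = sum-zero (cauchyTerm f g n) λ i →
    y≈0⇒x*y≈0 (f (toℕ i)) (g≈0 (n ∸ toℕ i) (ℕ.m∸n≤m n (toℕ i)))

  S*-comm : ∀ f g → (f S.* g) S.≈ (g S.* f)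
  S*-comm f g n = begin
    ∑[ i ≤ n ] (f (toℕ i) * g (n ∸ toℕ i))
      ≈⟨ ∑-permute (cauchyTerm f g n) reverse ⟩
    ∑[ i ≤ n ] (cauchyTerm f g n (opposite i))
      ≈⟨ sum-cong-≋ {suc n} {λ i → cauchyTerm f g n (opposite i)} {cauchyTerm g f n} step ⟩
    ∑[ i ≤ n ] (g (toℕ i) * f (n ∸ toℕ i)) ∎
    where
    step : ∀ i → cauchyTerm f g n (opposite i) ≈ cauchyTerm g f n i
    step i rewrite opposite-prop i | ℕ.m∸[m∸n]≡n (toℕ≤pred[n] i) = *-comm _ _

  S*-distribʳ : ∀ f g h → ((f S.+ g) S.* h) S.≈ ((f S.* h) S.+ (g S.* h))
  S*-distribʳ f g h n = trans
    (sum-cong-≋ {suc n} {cauchyTerm (f S.+ g) h n} {λ i → cauchyTerm f h n i + cauchyTerm g h n i}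
      λ i → distribʳ (h (n ∸ toℕ i)) (f (toℕ i)) (g (toℕ i)))
    (∑-distrib-+ (cauchyTerm f h n) (cauchyTerm g h n))

  S*-distribˡ : ∀ f g h → (f S.* (g S.+ h)) S.≈ ((f S.* g) S.+ (f S.* h))
  S*-distribˡ f g h n = begin
    (f S.* (g S.+ h)) n         ≈⟨ S*-comm f (g S.+ h) n ⟩
    ((g S.+ h) S.* f) n         ≈⟨ S*-distribʳ g h f n ⟩
    (g S.* f) n + (h S.* f) n   ≈⟨ +-cong (S*-comm g f n) (S*-comm h f n) ⟩
    (f S.* g) n + (f S.* h) n   ∎

  infixr 8 _·_
  _·_ : Carrier → Series → Series
  (a · f) n = a * f n

  S*-·ˡ : ∀ a f g → ((a · f) S.* g) S.≈ (a · (f S.* g))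
  S*-·ˡ a f g n = sym (trans
    (*-distribˡ-sum a (cauchyTerm f g n))
    (sum-cong-≋ {suc n} {λ i → a * cauchyTerm f g n i} {cauchyTerm (a · f) g n}
      λ i → sym (*-assoc a (f (toℕ i)) (g (n ∸ toℕ i)))))

  S*-·ʳ : ∀ a f g → (f S.* (a · g)) S.≈ (a · (f S.* g))
  S*-·ʳ a f g n = begin
    (f S.* (a · g)) n   ≈⟨ S*-comm f (a · g) n ⟩
    ((a · g) S.* f) n   ≈⟨ S*-·ˡ a g f n ⟩
    a * (g S.* f) n     ≈⟨ *-congˡ (S*-comm g f n) ⟩
    a * (f S.* g) n     ∎

  S*-negʳ : ∀ f g → (f S.* (S.- g)) S.≈ (S.- (f S.* g))
  S*-negʳ f g n = begin
    (f S.* (S.- g)) n      ≈⟨ S*-cong {f} (λ _ → refl) (λ i → sym (-1*x≈-x (g i))) n ⟩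
    (f S.* ((- 1#) · g)) n   ≈⟨ S*-·ʳ (- 1#) f g n ⟩
    - 1# * (f S.* g) n     ≈⟨ -1*x≈-x _ ⟩
    - (f S.* g) n          ∎

  S*-constˡ : ∀ a f → (const a S.* f) S.≈ (a · f)
  S*-constˡ a f zero    = +-identityʳ _
  S*-constˡ a f (suc n) = trans (+-congˡ (sum-zero (cauchyTerm (λ _ → 0#) f n) λ i → zeroˡ _)) (+-identityʳ _)

  S*-identityˡ : ∀ f → (S.1# S.* f) S.≈ f
  S*-identityˡ f n = trans (S*-constˡ 1# f n) (*-identityˡ (f n))

  S*-identityʳ : ∀ f → (f S.* S.1#) S.≈ f
  S*-identityʳ f n = trans (S*-comm f S.1# n) (S*-identityˡ f n)

  -- Each factor `w` raises the order by one: the product with `w 0` vanishes, and the other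
  -- products involve the remaining power only at indices below its exponent.
  ^-order : ∀ {w} → w 0 ≈ 0# → ∀ m {n} → n < m → (w S.^ m) n ≈ 0#
  ^-order {w} w₀≈0 (suc m) {zero}  _         = trans (+-identityʳ _) (x≈0⇒x*y≈0 _ w₀≈0)
  ^-order {w} w₀≈0 (suc m) {suc n} (s≤s n<m) = trans
    (+-cong (x≈0⇒x*y≈0 _ w₀≈0)
      (S*-zeroʳ (λ i → w (suc i)) (w S.^ m) n λ i i≤n → ^-order w₀≈0 m (ℕ.≤-<-trans i≤n n<m)))
    (+-identityˡ 0#)

  S*-var-suc : ∀ f n → (f S.* var) (suc n) ≈ f n
  S*-var-suc f n = begin
    (f S.* var) (suc n)                              ≈⟨ S*-comm f var (suc n) ⟩
    0# * f (suc n) + ((λ i → var (suc i)) S.* f) n   ≈⟨ +-cong (zeroˡ _) (S*-cong {g = f} var-tail (λ _ → refl) n) ⟩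
    0# + (S.1# S.* f) n                              ≈⟨ +-identityˡ _ ⟩
    (S.1# S.* f) n                                   ≈⟨ S*-identityˡ f n ⟩
    f n                                              ∎
    where
    var-tail : (λ i → var (suc i)) S.≈ S.1#
    var-tail zero    = refl
    var-tail (suc i) = refl

  S*-var-zero : ∀ f → (f S.* var) 0 ≈ 0#
  S*-var-zero f = trans (+-identityʳ _) (zeroʳ _)

  -- Derivations of power series and the power rule.

  -- The Euler operator t d/dt. It does not shift indices, so its Leibniz rule can be checked term
  -- by term; the one for d/dt is deduced from it.
  θ : Series → Series
  θ f n = fromℕ n * f n

  D : Series → Series
  D f n = θ f (suc n)

  -- (1 + μ t) d/dt
  δ : Carrier → Series → Series
  δ μ f = D f S.+ (μ · θ f)

  -- Degrees add: on the i-th Cauchy term the weight n splits as i + (n - i).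
  θ-Leibniz : ∀ f g → θ (f S.* g) S.≈ ((θ f S.* g) S.+ (f S.* θ g))
  θ-Leibniz f g n = begin
    fromℕ n * (f S.* g) n
      ≈⟨ *-distribˡ-sum (fromℕ n) (cauchyTerm f g n) ⟩
    ∑[ i ≤ n ] (fromℕ n * (f (toℕ i) * g (n ∸ toℕ i)))
      ≈⟨ sum-cong-≋ {suc n} {λ i → fromℕ n * cauchyTerm f g n i}
           {λ i → cauchyTerm (θ f) g n i + cauchyTerm f (θ g) n i} step ⟩
    ∑[ i ≤ n ] (θ f (toℕ i) * g (n ∸ toℕ i) + f (toℕ i) * θ g (n ∸ toℕ i))
      ≈⟨ ∑-distrib-+ (cauchyTerm (θ f) g n) (cauchyTerm f (θ g) n) ⟩
    (θ f S.* g) n + (f S.* θ g) n ∎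
    where
    step : ∀ (i : Fin (suc n)) → fromℕ n * (f (toℕ i) * g (n ∸ toℕ i))
         ≈ θ f (toℕ i) * g (n ∸ toℕ i) + f (toℕ i) * θ g (n ∸ toℕ i)
    step i = begin
      fromℕ n * (f (toℕ i) * g (n ∸ toℕ i))
        ≈⟨ *-congʳ (reflexive (≡.cong fromℕ (ℕ.m+[n∸m]≡n (toℕ≤pred[n] i)))) ⟨
      fromℕ (toℕ i ℕ.+ (n ∸ toℕ i)) * (f (toℕ i) * g (n ∸ toℕ i))
        ≈⟨ *-congʳ (×-homo-+ 1# (toℕ i) (n ∸ toℕ i)) ⟩
      (fromℕ (toℕ i) + fromℕ (n ∸ toℕ i)) * (f (toℕ i) * g (n ∸ toℕ i))
        ≈⟨ solve 4 (λ a b x y → (a :+ b) :* (x :* y) := a :* x :* y :+ x :* (b :* y)) refl _ _ _ _ ⟩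
      θ f (toℕ i) * g (n ∸ toℕ i) + f (toℕ i) * θ g (n ∸ toℕ i) ∎

  -- `θ f` is t times `D f`, so the shift by one degree can be taken out of the product. This
  -- carries the Leibniz rule from `θ` to `D`.
  θ-*-suc : ∀ f g n → (θ f S.* g) (suc n) ≈ (D f S.* g) n
  θ-*-suc f g n = trans (+-congʳ (x≈0⇒x*y≈0 _ (zeroˡ _))) (+-identityˡ _)

  D-Leibniz : ∀ f g → D (f S.* g) S.≈ ((D f S.* g) S.+ (f S.* D g))
  D-Leibniz f g n = begin
    D (f S.* g) n
      ≈⟨ θ-Leibniz f g (suc n) ⟩
    (θ f S.* g) (suc n) + (f S.* θ g) (suc n)
      ≈⟨ +-cong (θ-*-suc f g n) (S*-comm f (θ g) (suc n)) ⟩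
    (D f S.* g) n + (θ g S.* f) (suc n)
      ≈⟨ +-congˡ (trans (θ-*-suc g f n) (S*-comm (D g) f n)) ⟩
    (D f S.* g) n + (f S.* D g) n ∎

  δ-Leibniz : ∀ μ f g → δ μ (f S.* g) S.≈ ((δ μ f S.* g) S.+ (f S.* δ μ g))
  δ-Leibniz μ f g n = begin
    D (f S.* g) n + μ * θ (f S.* g) n
      ≈⟨ +-cong (D-Leibniz f g n) (*-congˡ (θ-Leibniz f g n)) ⟩
    ((D f S.* g) n + (f S.* D g) n) + μ * ((θ f S.* g) n + (f S.* θ g) n)
      ≈⟨ solve 5 (λ a b m x y → (a :+ b) :+ m :* (x :+ y) := (a :+ m :* x) :+ (b :+ m :* y)) refl _ _ _ _ _ ⟩
    ((D f S.* g) n + μ * (θ f S.* g) n) + ((f S.* D g) n + μ * (f S.* θ g) n)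
      ≈⟨ +-cong (+-congˡ (S*-·ˡ μ (θ f) g n)) (+-congˡ (S*-·ʳ μ f (θ g) n)) ⟨
    ((D f S.* g) n + ((μ · θ f) S.* g) n) + ((f S.* D g) n + (f S.* (μ · θ g)) n)
      ≈⟨ +-cong (S*-distribʳ (D f) (μ · θ f) g n) (S*-distribˡ f (D g) (μ · θ g) n) ⟨
    (δ μ f S.* g) n + (f S.* δ μ g) n ∎

  δ-+ : ∀ μ f g → δ μ (f S.+ g) S.≈ (δ μ f S.+ δ μ g)
  δ-+ μ f g n = solve 7
    (λ s i m x y z w → s :* (x :+ y) :+ m :* (i :* (z :+ w)) := (s :* x :+ m :* (i :* z)) :+ (s :* y :+ m :* (i :* w)))
    refl _ _ _ _ _ _ _

  δ-neg : ∀ μ f → δ μ (S.- f) S.≈ (S.- δ μ f)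
  δ-neg μ f n = begin
    fromℕ (suc n) * - f (suc n) + μ * (fromℕ n * - f n)
      ≈⟨ +-cong (*-congˡ (-1*x≈-x _)) (*-congˡ (*-congˡ (-1*x≈-x _))) ⟨
    fromℕ (suc n) * (- 1# * f (suc n)) + μ * (fromℕ n * (- 1# * f n))
      ≈⟨ solve 6 (λ s i m e x y → s :* (e :* x) :+ m :* (i :* (e :* y)) := e :* (s :* x :+ m :* (i :* y)))
           refl _ _ _ _ _ _ ⟩
    - 1# * δ μ f n
      ≈⟨ -1*x≈-x _ ⟩
    - δ μ f n ∎

  θ-1 : ∀ n → θ S.1# n ≈ 0#
  θ-1 zero    = zeroˡ _
  θ-1 (suc n) = zeroʳ _

  δ-1 : ∀ μ n → δ μ S.1# n ≈ 0#
  δ-1 μ n = trans (+-cong (θ-1 (suc n)) (y≈0⇒x*y≈0 μ (θ-1 n))) (+-identityˡ 0#)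

  -- The power rule, with the differential equation of `w` inserted so that only powers of `w`
  -- remain. It serves e^t - 1 (μ = 0, ε = 1) and 1 - (1 + ƛ t)^(-1/ƛ) (μ = ƛ, ε = -1).
  δ-^ : ∀ μ ε w → δ μ w S.≈ (S.1# S.+ (ε · w)) → ∀ m →
        δ μ (w S.^ suc m) S.≈ (fromℕ (suc m) · ((w S.^ m) S.+ (ε · (w S.^ suc m))))
  δ-^ μ ε w δw m n = begin
    δ μ (w S.^ suc m) n
      ≈⟨ δ-Leibniz μ w (w S.^ m) n ⟩
    (δ μ w S.* (w S.^ m)) n + (w S.* δ μ (w S.^ m)) n
      ≈⟨ +-cong first (second m) ⟩
    R m + fromℕ m * R m
      ≈⟨ trans (distribʳ (R m) 1# (fromℕ m)) (+-congʳ (*-identityˡ (R m))) ⟨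
    fromℕ (suc m) * R m ∎
    where
    R : ℕ → Carrier
    R m = (w S.^ m) n + ε * (w S.^ suc m) n

    first : (δ μ w S.* (w S.^ m)) n ≈ R m
    first = begin
      (δ μ w S.* (w S.^ m)) n
        ≈⟨ S*-cong {g = w S.^ m} δw (λ _ → refl) n ⟩
      ((S.1# S.+ (ε · w)) S.* (w S.^ m)) n
        ≈⟨ S*-distribʳ S.1# (ε · w) (w S.^ m) n ⟩
      (S.1# S.* (w S.^ m)) n + ((ε · w) S.* (w S.^ m)) n
        ≈⟨ +-cong (S*-identityˡ (w S.^ m) n) (S*-·ˡ ε w (w S.^ m) n) ⟩
      R m ∎

    -- The exponent is quantified afresh: at 0 the derivation kills the unit series, and at `suc m`
    -- the power rule for the smaller exponent is called recursively.
    second : ∀ m → (w S.* δ μ (w S.^ m)) n ≈ fromℕ m * R m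
    second zero = begin
      (w S.* δ μ S.1#) n   ≈⟨ S*-zeroʳ w (δ μ S.1#) n (λ i _ → δ-1 μ i) ⟩
      0#                   ≈⟨ zeroˡ _ ⟨
      0# * R 0             ∎
    second (suc m) = begin
      (w S.* δ μ (w S.^ suc m)) n
        ≈⟨ S*-cong {w} (λ _ → refl) (δ-^ μ ε w δw m) n ⟩
      (w S.* (fromℕ (suc m) · ((w S.^ m) S.+ (ε · (w S.^ suc m))))) n
        ≈⟨ S*-·ʳ (fromℕ (suc m)) w ((w S.^ m) S.+ (ε · (w S.^ suc m))) n ⟩
      fromℕ (suc m) * (w S.* ((w S.^ m) S.+ (ε · (w S.^ suc m)))) n
        ≈⟨ *-congˡ (S*-distribˡ w (w S.^ m) (ε · (w S.^ suc m)) n) ⟩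
      fromℕ (suc m) * ((w S.^ suc m) n + (w S.* (ε · (w S.^ suc m))) n)
        ≈⟨ *-congˡ (+-congˡ (S*-·ʳ ε w (w S.^ suc m) n)) ⟩
      fromℕ (suc m) * R (suc m) ∎

  -- Stirling numbers of the first kind and their degenerate form.

  S0≈0 : ∀ l → S.0# l ≈ 0#
  S0≈0 zero    = refl
  S0≈0 (suc l) = refl

  -- Compare coefficients in (x)_(n+1) = (x)_n (x - n). The multiple of n stands on the left, so
  -- that the right side is a pure multiplication by x, that is, an index shift.
  S₁-suc : ∀ n l → S₁ (suc n) l + fromℕ n * S₁ n l ≈ (S₁ n S.* var) l
  S₁-suc n l = begin
    (S₁ n S.* (var S.+ (S.- n×1))) l + fromℕ n * S₁ n l
      ≈⟨ +-congʳ (S*-distribˡ (S₁ n) var (S.- n×1) l) ⟩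
    (S₁ n S.* var) l + (S₁ n S.* (S.- n×1)) l + fromℕ n * S₁ n l
      ≈⟨ +-congʳ (+-congˡ (S*-negʳ (S₁ n) n×1 l)) ⟩
    (S₁ n S.* var) l - (S₁ n S.* n×1) l + fromℕ n * S₁ n l
      ≈⟨ +-congˡ S₁*n ⟨
    (S₁ n S.* var) l - (S₁ n S.* n×1) l + (S₁ n S.* n×1) l
      ≈⟨ +-assoc _ _ _ ⟩
    (S₁ n S.* var) l + (- (S₁ n S.* n×1) l + (S₁ n S.* n×1) l)
      ≈⟨ +-congˡ (-‿inverseˡ _) ⟩
    (S₁ n S.* var) l + 0#
      ≈⟨ +-identityʳ _ ⟩
    (S₁ n S.* var) l ∎
    where
    open RawSemiringDefinitions S.rawSemiring using () renaming (_×_ to _×ₛ_)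

    n×1 : Series
    n×1 = n ×ₛ S.1#

    -- In the falling factorial of series the constant n is an n-fold sum of the unit series; this
    -- identifies it with a scalar.
    ×ₛ-· : ∀ n f l → (n ×ₛ f) l ≈ fromℕ n * f l
    ×ₛ-· zero    f l = trans (S0≈0 l) (sym (zeroˡ (f l)))
    ×ₛ-· (suc n) f l = begin
      f l + (n ×ₛ f) l            ≈⟨ +-cong (sym (*-identityˡ (f l))) (×ₛ-· n f l) ⟩
      1# * f l + fromℕ n * f l    ≈⟨ distribʳ (f l) 1# (fromℕ n) ⟨
      fromℕ (suc n) * f l         ∎

    S₁*n : (S₁ n S.* n×1) l ≈ fromℕ n * S₁ n l
    S₁*n = begin
      (S₁ n S.* n×1) l                  ≈⟨ S*-cong {S₁ n} (λ _ → refl) (×ₛ-· n S.1#) l ⟩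
      (S₁ n S.* (fromℕ n · S.1#)) l     ≈⟨ S*-·ʳ (fromℕ n) (S₁ n) S.1# l ⟩
      fromℕ n * (S₁ n S.* S.1#) l       ≈⟨ *-congˡ (S*-identityʳ (S₁ n) l) ⟩
      fromℕ n * S₁ n l                  ∎

  S₁-vanishes : ∀ {n l} → n < l → S₁ n l ≈ 0#
  S₁-vanishes {zero}  {suc l} _         = refl
  S₁-vanishes {suc n} {suc l} (s≤s n<l) = begin
    S₁ (suc n) (suc l)
      ≈⟨ +-identityʳ _ ⟨
    S₁ (suc n) (suc l) + 0#
      ≈⟨ +-congˡ (y≈0⇒x*y≈0 (fromℕ n) (S₁-vanishes (ℕ.m<n⇒m<1+n n<l))) ⟨
    S₁ (suc n) (suc l) + fromℕ n * S₁ n (suc l)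
      ≈⟨ S₁-suc n (suc l) ⟩
    (S₁ n S.* var) (suc l)
      ≈⟨ S*-var-suc (S₁ n) l ⟩
    S₁ n l
      ≈⟨ S₁-vanishes n<l ⟩
    0# ∎

  -- The coefficient of xˡ in x (x - ƛ) ⋯ (x - (n - 1) ƛ).
  degenerateS₁ : Carrier → ℕ → ℕ → Carrier
  degenerateS₁ ƛ n l = ƛ ^ (n ∸ l) * S₁ n l

  degenerateS₁-vanishes : ∀ ƛ {n l} → n < l → degenerateS₁ ƛ n l ≈ 0#
  degenerateS₁-vanishes ƛ n<l = y≈0⇒x*y≈0 _ (S₁-vanishes n<l)

  degenerateS₁-suc-zero : ∀ ƛ n → degenerateS₁ ƛ (suc n) 0 + fromℕ n * ƛ * degenerateS₁ ƛ n 0 ≈ 0#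
  degenerateS₁-suc-zero ƛ n = begin
    ƛ * ƛ ^ n * S₁ (suc n) 0 + fromℕ n * ƛ * (ƛ ^ n * S₁ n 0)
      ≈⟨ solve 5 (λ x y a n b → x :* y :* a :+ n :* x :* (y :* b) := x :* y :* (a :+ n :* b)) refl
           ƛ (ƛ ^ n) (S₁ (suc n) 0) (fromℕ n) (S₁ n 0) ⟩
    ƛ * ƛ ^ n * (S₁ (suc n) 0 + fromℕ n * S₁ n 0)
      ≈⟨ y≈0⇒x*y≈0 _ (trans (S₁-suc n 0) (S*-var-zero (S₁ n))) ⟩
    0# ∎

  -- The recurrence `S₁-suc` at l + 1, multiplied by ƛ^(n-l); it reflects multiplication by x - nƛ.
  degenerateS₁-suc-suc : ∀ ƛ n l →
    degenerateS₁ ƛ (suc n) (suc l) + fromℕ n * ƛ * degenerateS₁ ƛ n (suc l) ≈ degenerateS₁ ƛ n l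
  degenerateS₁-suc-suc ƛ n l = begin
    ƛ ^ (n ∸ l) * S₁ (suc n) (suc l) + fromℕ n * ƛ * degenerateS₁ ƛ n (suc l)
      ≈⟨ +-congˡ (*-assoc _ _ _) ⟩
    ƛ ^ (n ∸ l) * S₁ (suc n) (suc l) + fromℕ n * (ƛ * degenerateS₁ ƛ n (suc l))
      ≈⟨ +-congˡ (*-congˡ lower) ⟩
    ƛ ^ (n ∸ l) * S₁ (suc n) (suc l) + fromℕ n * (ƛ ^ (n ∸ l) * S₁ n (suc l))
      ≈⟨ solve 4 (λ y a n b → y :* a :+ n :* (y :* b) := y :* (a :+ n :* b)) refl
           (ƛ ^ (n ∸ l)) (S₁ (suc n) (suc l)) (fromℕ n) (S₁ n (suc l)) ⟩
    ƛ ^ (n ∸ l) * (S₁ (suc n) (suc l) + fromℕ n * S₁ n (suc l))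
      ≈⟨ *-congˡ (trans (S₁-suc n (suc l)) (S*-var-suc (S₁ n) l)) ⟩
    ƛ ^ (n ∸ l) * S₁ n l ∎
    where
    -- For l < n the exponents n - (l + 1) and n - l differ by one. Otherwise truncated subtraction
    -- makes both 0, but then the Stirling number vanishes.
    lower : ƛ * degenerateS₁ ƛ n (suc l) ≈ ƛ ^ (n ∸ l) * S₁ n (suc l)
    lower with l ℕ.<? n
    ... | yes l<n = trans (sym (*-assoc _ _ _))
                      (*-congʳ (reflexive (≡.cong (ƛ ^_) (≡.sym (ℕ.+-∸-assoc 1 l<n)))))
    ... | no  l≮n = trans (y≈0⇒x*y≈0 ƛ (degenerateS₁-vanishes ƛ n<1+l)) (sym (y≈0⇒x*y≈0 _ (S₁-vanishes n<1+l)))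
      where
      n<1+l : n < suc l
      n<1+l = s≤s (ℕ.≮⇒≥ l≮n)

  -- The change of variable s = log(1 + ƛ t) / ƛ on coefficients.

  module Transform (ƛ : Carrier) where

    -- If h l = l! [tˡ] f, this is n! [tⁿ] f(log(1 + ƛ t) / ƛ).
    transformTerm : ℕ → (ℕ → Carrier) → ℕ → Carrier
    transformTerm n h l = degenerateS₁ ƛ n l * h l

    transform : ℕ → (ℕ → Carrier) → Carrier
    transform n h = ∑[ l ≤ n ] transformTerm n h (toℕ l)

    transform-cong : ∀ n {g h} → (∀ l → g l ≈ h l) → transform n g ≈ transform n h
    transform-cong n {g} {h} g≈h =
      sum-cong-≋ {suc n} {λ l → transformTerm n g (toℕ l)} {λ l → transformTerm n h (toℕ l)}
        λ l → *-congˡ (g≈h (toℕ l))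

    transform-zero : ∀ n {h} → (∀ l → h l ≈ 0#) → transform n h ≈ 0#
    transform-zero n {h} h≈0 = sum-zero {suc n} (λ l → transformTerm n h (toℕ l)) λ l → y≈0⇒x*y≈0 _ (h≈0 (toℕ l))

    transform-· : ∀ n a h → transform n (λ l → a * h l) ≈ a * transform n h
    transform-· n a h = sym (trans
      (*-distribˡ-sum {suc n} a (λ l → transformTerm n h (toℕ l)))
      (sum-cong-≋ {suc n} {λ l → a * transformTerm n h (toℕ l)} {λ l → transformTerm n (a · h) (toℕ l)}
        λ l → solve 3 (λ a x y → a :* (x :* y) := x :* (a :* y)) refl a (degenerateS₁ ƛ n (toℕ l)) (h (toℕ l))))

    transform-+ : ∀ n g h → transform n (λ l → g l + h l) ≈ transform n g + transform n h
    transform-+ n g h = trans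
      (sum-cong-≋ {suc n} {λ l → transformTerm n (g S.+ h) (toℕ l)}
        {λ l → transformTerm n g (toℕ l) + transformTerm n h (toℕ l)}
        λ l → distribˡ (degenerateS₁ ƛ n (toℕ l)) (g (toℕ l)) (h (toℕ l)))
      (∑-distrib-+ {suc n} (λ l → transformTerm n g (toℕ l)) (λ l → transformTerm n h (toℕ l)))

    -- The chain rule: under s = log(1 + ƛ t) / ƛ the derivation (1 + ƛ t) d/dt becomes d/ds, and
    -- d/ds shifts the sequence l! [s^l] f by one.
    transform-suc : ∀ n h → transform (suc n) h + fromℕ n * ƛ * transform n h ≈ transform n (λ l → h (suc l))
    transform-suc n h = begin
      transform (suc n) h + nƛ * transform n h
        -- A zero term at l = n + 1 gives both sums the same range.
        ≈⟨ +-congˡ (*-congˡ (sum-extend (transformTerm n h) (ℕ.n≤1+n (suc n))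
             λ l n<l → x≈0⇒x*y≈0 (h l) (degenerateS₁-vanishes ƛ n<l))) ⟩
      transform (suc n) h + nƛ * ∑[ l ≤ suc n ] transformTerm n h (toℕ l)
        ≈⟨ +-congˡ (*-distribˡ-sum {suc (suc n)} nƛ (λ l → transformTerm n h (toℕ l))) ⟩
      transform (suc n) h + ∑[ l ≤ suc n ] (nƛ * transformTerm n h (toℕ l))
        ≈⟨ ∑-distrib-+ {suc (suc n)} (λ l → transformTerm (suc n) h (toℕ l)) (λ l → nƛ * transformTerm n h (toℕ l)) ⟨
      ∑[ l ≤ suc n ] (step (toℕ l))
        -- The term l = 0 vanishes, and the recurrence at l + 1 leaves the l-th coefficient for n.
        ≈⟨ +-cong (trans (combine 0) (x≈0⇒x*y≈0 (h 0) (degenerateS₁-suc-zero ƛ n)))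
             (sum-cong-≋ {suc n} {λ l → step (suc (toℕ l))} {λ l → transformTerm n (λ l → h (suc l)) (toℕ l)}
               λ l → trans (combine (suc (toℕ l))) (*-congʳ (degenerateS₁-suc-suc ƛ n (toℕ l)))) ⟩
      0# + transform n (λ l → h (suc l))
        ≈⟨ +-identityˡ _ ⟩
      transform n (λ l → h (suc l)) ∎
      where
      nƛ : Carrier
      nƛ = fromℕ n * ƛ

      step : ℕ → Carrier
      step l = transformTerm (suc n) h l + nƛ * transformTerm n h l

      combine : ∀ l → step l ≈ (degenerateS₁ ƛ (suc n) l + nƛ * degenerateS₁ ƛ n l) * h l
      combine l = solve 4 (λ a c b x → a :* x :+ c :* (b :* x) := (a :+ c :* b) :* x) refl
        (degenerateS₁ ƛ (suc n) l) nƛ (degenerateS₁ ƛ n l) (h l)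

    -- The left side has the shape of the one in `transform-suc`, so a differential equation for `f`
    -- can be matched with the recurrence of the transform.
    n!*δ : ∀ n f → fromℕ (suc n !) * f (suc n) + fromℕ n * ƛ * (fromℕ (n !) * f n) ≈ fromℕ (n !) * δ ƛ f n
    n!*δ n f = trans (+-congʳ (*-congʳ (fromℕ-suc! n)))
      (solve 6 (λ s a x n ƛ y → s :* a :* x :+ n :* ƛ :* (a :* y) := a :* (s :* x :+ ƛ :* (n :* y))) refl
        (fromℕ (suc n)) (fromℕ (n !)) (f (suc n)) (fromℕ n) ƛ (f n))

  -- Coefficients of the powers of u.

  -1*-1≈1 : - 1# * - 1# ≈ 1#
  -1*-1≈1 = trans (-1*x≈-x (- 1#)) (-‿involutive 1#)

  -- l! [tˡ] (-f(-t))ᵐ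
  signedCoefficient : Series → ℕ → ℕ → Carrier
  signedCoefficient f m l = (- 1#) ^ l * (- 1#) ^ m * (fromℕ (l !) * (f S.^ m) l)

  -- If w' = 1 + w, then v(t) = -w(-t) satisfies v' = 1 - v, hence (v^(m+1))' = (m + 1)(v^m -
  -- v^(m+1)); this is the coefficient form.
  signedCoefficient-suc : ∀ w → (∀ n → δ 0# w n ≈ S.1# n + 1# * w n) → ∀ m l →
    signedCoefficient w (suc m) (suc l)
      ≈ fromℕ (suc m) * (signedCoefficient w m l + - 1# * signedCoefficient w (suc m) l)
  signedCoefficient-suc w δw m l = begin
    - 1# * σl * (- 1# * σm) * (fromℕ (suc l !) * v)
      ≈⟨ *-congˡ (*-congʳ (fromℕ-suc! l)) ⟩
    - 1# * σl * (- 1# * σm) * (fromℕ (suc l) * fromℕ (l !) * v)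
      ≈⟨ solve 6 (λ e a b s f v → e :* a :* (e :* b) :* (s :* f :* v) := e :* e :* (a :* b :* (f :* (s :* v)))) refl
           (- 1#) σl σm (fromℕ (suc l)) (fromℕ (l !)) v ⟩
    - 1# * - 1# * (σl * σm * (fromℕ (l !) * (fromℕ (suc l) * v)))
      ≈⟨ *-congˡ (*-congˡ (*-congˡ D-^)) ⟩
    - 1# * - 1# * (σl * σm * (fromℕ (l !) * (fromℕ (suc m) * (x + y))))
      ≈⟨ solve 7 (λ ε a b f s x y → ε :* (a :* b :* (f :* (s :* (x :+ y))))
                    := s :* (ε :* (a :* b :* (f :* x)) :+ ε :* (a :* b :* (f :* y)))) refl
           (- 1# * - 1#) σl σm (fromℕ (l !)) (fromℕ (suc m)) x y ⟩
    fromℕ (suc m) * (- 1# * - 1# * signedCoefficient w m l + - 1# * - 1# * (σl * σm * (fromℕ (l !) * y)))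
      ≈⟨ *-congˡ (+-cong (trans (*-congʳ -1*-1≈1) (*-identityˡ _))
           (solve 5 (λ e a b f y → e :* e :* (a :* b :* (f :* y)) := e :* (a :* (e :* b) :* (f :* y))) refl
             (- 1#) σl σm (fromℕ (l !)) y)) ⟩
    fromℕ (suc m) * (signedCoefficient w m l + - 1# * signedCoefficient w (suc m) l) ∎
    where
    σl σm v x y : Carrier
    σl = (- 1#) ^ l
    σm = (- 1#) ^ m
    v = (w S.^ suc m) (suc l)
    x = (w S.^ m) l
    y = (w S.^ suc m) l

    D-^ : fromℕ (suc l) * v ≈ fromℕ (suc m) * (x + y)
    D-^ = begin
      fromℕ (suc l) * v                                  ≈⟨ +-identityʳ _ ⟨
      fromℕ (suc l) * v + 0#                             ≈⟨ +-congˡ (zeroˡ _) ⟨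
      δ 0# (w S.^ suc m) l                               ≈⟨ δ-^ 0# 1# w δw m l ⟩
      fromℕ (suc m) * (x + 1# * y)                       ≈⟨ *-congˡ (+-congˡ (*-identityˡ y)) ⟩
      fromℕ (suc m) * (x + y)                            ∎

  -- In the application w = eˢ - 1 and u = 1 - e⁻ˢ with s = log(1 + ƛ t) / ƛ; here both series
  -- are characterised by their differential equations.
  power-coefficient : ∀ ƛ w u → w 0 ≈ 0# → u 0 ≈ 0# →
    (∀ n → δ 0# w n ≈ S.1# n + 1# * w n) → (∀ n → δ ƛ u n ≈ S.1# n + - 1# * u n) →
    ∀ n m → fromℕ (n !) * (u S.^ m) n ≈ Transform.transform ƛ n (signedCoefficient w m)
  power-coefficient ƛ w u w₀≈0 u₀≈0 δw δu = go
    where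
    open Transform ƛ

    h : ℕ → ℕ → Carrier
    h = signedCoefficient w

    -- Induction on n for all m at once: `go` at n + 1 uses `go-δ` at n, which for a positive
    -- exponent uses `go` at n for that exponent and the one below.
    go : ∀ n m → fromℕ (n !) * (u S.^ m) n ≈ transform n (h m)
    go-δ : ∀ n m → fromℕ (n !) * δ ƛ (u S.^ m) n ≈ transform n (λ l → h m (suc l))

    go zero zero = sym (trans (+-identityʳ _) (trans (*-cong (*-identityˡ 1#) (*-congʳ (*-identityˡ 1#)))
                     (trans (*-identityˡ _) (*-identityˡ _))))
    go zero (suc m) = trans (y≈0⇒x*y≈0 (fromℕ (0 !)) (^-order u₀≈0 (suc m) z<s)) (sym (trans (+-identityʳ _)
      (y≈0⇒x*y≈0 (degenerateS₁ ƛ 0 0) (y≈0⇒x*y≈0 ((- 1#) ^ 0 * (- 1#) ^ suc m)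
        (y≈0⇒x*y≈0 (fromℕ (0 !)) (^-order w₀≈0 (suc m) z<s))))))
    -- Adding nƛ times the value at n completes both sides to a derivative; the added term is
    -- cancelled afterwards.
    go (suc n) m = +-cancelʳ (fromℕ n * ƛ * transform n (h m)) _ _ (begin
      fromℕ (suc n !) * (u S.^ m) (suc n) + fromℕ n * ƛ * transform n (h m)
        ≈⟨ +-congˡ (*-congˡ (go n m)) ⟨
      fromℕ (suc n !) * (u S.^ m) (suc n) + fromℕ n * ƛ * (fromℕ (n !) * (u S.^ m) n)
        ≈⟨ n!*δ n (u S.^ m) ⟩
      fromℕ (n !) * δ ƛ (u S.^ m) n
        ≈⟨ go-δ n m ⟩
      transform n (λ l → h m (suc l))
        ≈⟨ transform-suc n (h m) ⟨
      transform (suc n) (h m) + fromℕ n * ƛ * transform n (h m) ∎)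

    go-δ n zero = trans (y≈0⇒x*y≈0 _ (δ-1 ƛ n))
      (sym (transform-zero n λ l → y≈0⇒x*y≈0 ((- 1#) ^ suc l * (- 1#) ^ 0) (zeroʳ (fromℕ (suc l !)))))
    go-δ n (suc m) = begin
      fromℕ (n !) * δ ƛ (u S.^ suc m) n
        ≈⟨ *-congˡ (δ-^ ƛ (- 1#) u δu m n) ⟩
      fromℕ (n !) * (fromℕ (suc m) * ((u S.^ m) n + - 1# * (u S.^ suc m) n))
        ≈⟨ solve 5 (λ f s x e y → f :* (s :* (x :+ e :* y)) := s :* (f :* x :+ e :* (f :* y))) refl
             (fromℕ (n !)) (fromℕ (suc m)) ((u S.^ m) n) (- 1#) ((u S.^ suc m) n) ⟩
      fromℕ (suc m) * (fromℕ (n !) * (u S.^ m) n + - 1# * (fromℕ (n !) * (u S.^ suc m) n))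
        ≈⟨ *-congˡ (+-cong (go n m) (*-congˡ (go n (suc m)))) ⟩
      fromℕ (suc m) * (transform n (h m) + - 1# * transform n (h (suc m)))
        ≈⟨ *-congˡ (+-congˡ (transform-· n (- 1#) (h (suc m)))) ⟨
      fromℕ (suc m) * (transform n (h m) + transform n (λ l → - 1# * h (suc m) l))
        ≈⟨ *-congˡ (transform-+ n (h m) (λ l → - 1# * h (suc m) l)) ⟨
      fromℕ (suc m) * transform n (λ l → h m l + - 1# * h (suc m) l)
        ≈⟨ transform-· n (fromℕ (suc m)) (λ l → h m l + - 1# * h (suc m) l) ⟨
      transform n (λ l → fromℕ (suc m) * (h m l + - 1# * h (suc m) l))
        ≈⟨ transform-cong n (signedCoefficient-suc w δw m) ⟨
      transform n (λ l → h (suc m) (suc l)) ∎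

  -- Differential equations of the exponential and binomial series.

  x+[y-x]≈y : ∀ x y → x + (y - x) ≈ y
  x+[y-x]≈y x y = begin
    x + (y - x)       ≈⟨ solve 3 (λ x y z → x :+ (y :+ z) := y :+ (x :+ z)) refl x y (- x) ⟩
    y + (x - x)       ≈⟨ +-congˡ (-‿inverseʳ x) ⟩
    y + 0#            ≈⟨ +-identityʳ y ⟩
    y                 ∎

  exp-1 : Series
  exp-1 = exp S.+ (S.- S.1#)

  exp-1-zero : exp-1 0 ≈ 0#
  exp-1-zero = trans (+-congʳ factorialInverse-zero) (-‿inverseʳ 1#)

  δ-exp-1 : ∀ n → δ 0# exp-1 n ≈ S.1# n + 1# * exp-1 n
  δ-exp-1 n = begin
    δ 0# exp-1 n
      ≈⟨ δ-+ 0# exp (S.- S.1#) n ⟩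
    δ 0# exp n + δ 0# (S.- S.1#) n
      ≈⟨ +-cong (trans (+-congˡ (zeroˡ _)) (+-identityʳ _)) (trans (δ-neg 0# S.1# n) (-‿cong (δ-1 0# n))) ⟩
    fromℕ (suc n) * factorialInverse (suc n) - 0#
      ≈⟨ +-cong (factorialInverse-suc n) -0#≈0# ⟩
    exp n + 0#
      ≈⟨ +-identityʳ _ ⟩
    exp n
      ≈⟨ x+[y-x]≈y (S.1# n) (exp n) ⟨
    S.1# n + exp-1 n
      ≈⟨ +-congˡ (*-identityˡ _) ⟨
    S.1# n + 1# * exp-1 n ∎

  fallingFactorial-cong : ∀ {a b} → a ≈ b → ∀ n → fallingFactorial rawRing a n ≈ fallingFactorial rawRing b n
  fallingFactorial-cong a≈b zero    = refl
  fallingFactorial-cong a≈b (suc n) = *-cong (fallingFactorial-cong a≈b n) (+-congʳ a≈b)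

  fallingFactorial-zero : ∀ {a} → a ≈ 0# → ∀ n → fallingFactorial rawRing a (suc n) ≈ 0#
  fallingFactorial-zero {a} a≈0 zero    = y≈0⇒x*y≈0 1# (trans (+-cong a≈0 -0#≈0#) (+-identityʳ 0#))
  fallingFactorial-zero {a} a≈0 (suc n) = x≈0⇒x*y≈0 _ (fallingFactorial-zero a≈0 n)

  binomialSeries-cong : ∀ ƛ {a b} → a ≈ b → binomialSeries ƛ a S.≈ binomialSeries ƛ b
  binomialSeries-cong ƛ a≈b n = *-congʳ (*-congʳ (fallingFactorial-cong a≈b n))

  binomialSeries-constant : ∀ ƛ a → binomialSeries ƛ a 0 ≈ 1#
  binomialSeries-constant ƛ a = trans (*-cong (*-identityˡ 1#) factorialInverse-zero) (*-identityˡ 1#)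

  binomialSeries-zero : ∀ ƛ {a} → a ≈ 0# → binomialSeries ƛ a S.≈ S.1#
  binomialSeries-zero ƛ {a} a≈0 zero = binomialSeries-constant ƛ a
  binomialSeries-zero ƛ a≈0 (suc n)  = x≈0⇒x*y≈0 _ (x≈0⇒x*y≈0 _ (fallingFactorial-zero a≈0 n))

  -- In degree n, d/dt contributes the factor a - n and ƛ t d/dt the factor n; together they give a.
  δ-binomialSeries : ∀ ƛ a n → δ ƛ (binomialSeries ƛ a) n ≈ ƛ * a * binomialSeries ƛ a n
  δ-binomialSeries ƛ a n = begin
    fromℕ (suc n) * (ff * (a - fromℕ n) * (ƛ * p) * factorialInverse (suc n)) + ƛ * (fromℕ n * (ff * p * exp n))
      ≈⟨ +-congʳ (solve 6 (λ s f b ƛ p i → s :* (f :* b :* (ƛ :* p) :* i) := f :* b :* (ƛ :* p) :* (s :* i)) refl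
           (fromℕ (suc n)) ff (a - fromℕ n) ƛ p (factorialInverse (suc n))) ⟩
    ff * (a - fromℕ n) * (ƛ * p) * (fromℕ (suc n) * factorialInverse (suc n)) + ƛ * (fromℕ n * (ff * p * exp n))
      ≈⟨ +-congʳ (*-congˡ (factorialInverse-suc n)) ⟩
    ff * (a - fromℕ n) * (ƛ * p) * exp n + ƛ * (fromℕ n * (ff * p * exp n))
      ≈⟨ solve 6 (λ f b ƛ p i n → f :* b :* (ƛ :* p) :* i :+ ƛ :* (n :* (f :* p :* i)) := ƛ :* (n :+ b) :* (f :* p :* i))
           refl ff (a - fromℕ n) ƛ p (exp n) (fromℕ n) ⟩
    ƛ * (fromℕ n + (a - fromℕ n)) * (ff * p * exp n)
      ≈⟨ *-congʳ (*-congˡ (x+[y-x]≈y (fromℕ n) a)) ⟩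
    ƛ * a * binomialSeries ƛ a n ∎
    where
    ff p : Carrier
    ff = fallingFactorial rawRing a n
    p = ƛ ^ n

  1-binomialSeries : Carrier → Carrier → Series
  1-binomialSeries ƛ a = S.1# S.+ (S.- binomialSeries ƛ a)

  1-binomialSeries-zero : ∀ ƛ a → 1-binomialSeries ƛ a 0 ≈ 0#
  1-binomialSeries-zero ƛ a = trans (+-congˡ (-‿cong (binomialSeries-constant ƛ a))) (-‿inverseʳ 1#)

  -- For a = -1/ƛ the binomial series is an eigenvector of `δ ƛ` with eigenvalue -1.
  δ-1-binomialSeries : ∀ {ƛ a} → ƛ * a ≈ - 1# → ∀ n →
    δ ƛ (1-binomialSeries ƛ a) n ≈ S.1# n + - 1# * 1-binomialSeries ƛ a n
  δ-1-binomialSeries {ƛ} {a} ƛa≈-1 n = begin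
    δ ƛ (1-binomialSeries ƛ a) n
      ≈⟨ δ-+ ƛ S.1# (S.- B) n ⟩
    δ ƛ S.1# n + δ ƛ (S.- B) n
      ≈⟨ +-cong (δ-1 ƛ n) (δ-neg ƛ B n) ⟩
    0# - δ ƛ B n
      ≈⟨ +-identityˡ _ ⟩
    - δ ƛ B n
      ≈⟨ -‿cong (trans (δ-binomialSeries ƛ a n) (trans (*-congʳ ƛa≈-1) (-1*x≈-x (B n)))) ⟩
    - - B n
      ≈⟨ x+[y-x]≈y (S.1# n) (- - B n) ⟨
    S.1# n + (- - B n - S.1# n)
      ≈⟨ +-congˡ (trans (+-comm _ _) (-‿+-comm (S.1# n) (- B n))) ⟩
    S.1# n - 1-binomialSeries ƛ a n
      ≈⟨ +-congˡ (-1*x≈-x _) ⟨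
    S.1# n + - 1# * 1-binomialSeries ƛ a n ∎
    where
    B : Series
    B = binomialSeries ƛ a

  -- Multiplying a substituted series by its argument.

  -- For `a` = `Li/u k` this recovers the polylogarithm itself. The sum can stop before n, since
  -- u^(m+1) has order above n once m reaches n.
  substitute-* : ∀ a u → u 0 ≈ 0# → ∀ n → (substitute a u S.* u) n ≈ ∑[ m < n ] (a (toℕ m) * (u S.^ suc (toℕ m)) n)
  substitute-* a u u₀≈0 n = begin
    (substitute a u S.* u) n
      ≈⟨ S*-comm (substitute a u) u n ⟩
    ∑[ i ≤ n ] (u (toℕ i) * substitute a u (n ∸ toℕ i))
      ≈⟨ sum-cong-≋ {suc n} {cauchyTerm u (substitute a u) n} {λ i → ∑[ m ≤ n ] summand i m} expand ⟩
    ∑[ i ≤ n ] ∑[ m ≤ n ] summand i m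
      ≈⟨ ∑-comm {suc n} {suc n} summand ⟩
    ∑[ m ≤ n ] ∑[ i ≤ n ] summand i m
      ≈⟨ sum-cong-≋ {suc n} {λ m → ∑[ i ≤ n ] summand i m} {λ m → a (toℕ m) * (u S.^ suc (toℕ m)) n}
           (λ m → sym (*-distribˡ-sum {suc n} (a (toℕ m)) (cauchyTerm u (u S.^ toℕ m) n))) ⟩
    ∑[ m ≤ n ] (a (toℕ m) * (u S.^ suc (toℕ m)) n)
      ≈⟨ sum-extend (λ m → a m * (u S.^ suc m) n) (ℕ.n≤1+n n)
           (λ m n≤m → y≈0⇒x*y≈0 (a m) (^-order u₀≈0 (suc m) (s≤s n≤m))) ⟨
    ∑[ m < n ] (a (toℕ m) * (u S.^ suc (toℕ m)) n) ∎
    where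
    summand : Fin (suc n) → Fin (suc n) → Carrier
    summand i m = a (toℕ m) * (u (toℕ i) * (u S.^ toℕ m) (n ∸ toℕ i))

    -- `substitute` cuts its sum at the index n - i of the coefficient. Padding to the common bound
    -- n makes the double sum rectangular, so that its order can be exchanged.
    expand : ∀ i → u (toℕ i) * substitute a u (n ∸ toℕ i) ≈ ∑[ m ≤ n ] summand i m
    expand i = begin
      u (toℕ i) * substitute a u j
        ≈⟨ *-congˡ (sum-extend (λ m → a m * (u S.^ m) j) (s≤s (ℕ.m∸n≤m n (toℕ i)))
             λ m j<m → y≈0⇒x*y≈0 (a m) (^-order u₀≈0 m j<m)) ⟩
      u (toℕ i) * ∑[ m ≤ n ] (a (toℕ m) * (u S.^ toℕ m) j)
        ≈⟨ *-distribˡ-sum {suc n} (u (toℕ i)) (λ m → a (toℕ m) * (u S.^ toℕ m) j) ⟩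
      ∑[ m ≤ n ] (u (toℕ i) * (a (toℕ m) * (u S.^ toℕ m) j))
        ≈⟨ sum-cong-≋ {suc n} {λ m → u (toℕ i) * (a (toℕ m) * (u S.^ toℕ m) j)} {summand i}
             (λ m → solve 3 (λ x y z → x :* (y :* z) := y :* (x :* z)) refl (u (toℕ i)) (a (toℕ m)) ((u S.^ toℕ m) j)) ⟩
      ∑[ m ≤ n ] summand i m ∎
      where
      j = n ∸ toℕ i

  -- The difference of the poly-Bernoulli values.

  [-1]^-∸ : ∀ {m l} → m ≤ l → (- 1#) ^ l * (- 1#) ^ m ≈ (- 1#) ^ (l ∸ m)
  [-1]^-∸ z≤n = *-identityʳ _
  [-1]^-∸ {suc m} {suc l} (s≤s m≤l) = begin
    - 1# * (- 1#) ^ l * (- 1# * (- 1#) ^ m)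
      ≈⟨ solve 3 (λ e x y → e :* x :* (e :* y) := e :* e :* (x :* y)) refl (- 1#) ((- 1#) ^ l) ((- 1#) ^ m) ⟩
    - 1# * - 1# * ((- 1#) ^ l * (- 1#) ^ m)
      ≈⟨ trans (*-congʳ -1*-1≈1) (*-identityˡ _) ⟩
    (- 1#) ^ l * (- 1#) ^ m
      ≈⟨ [-1]^-∸ m≤l ⟩
    (- 1#) ^ (l ∸ m) ∎

  module _ (k : ℤ) (ƛ : Carrier) (ƛ#0 : ƛ # 0#) (n : ℕ) where
    open Transform ƛ

    private
      1/ƛ : Carrier
      1/ƛ = inverse ƛ ƛ#0

      u A : Series
      u = 1-binomialSeries ƛ (- 1/ƛ)
      A = substitute (Li/u k) u

      term : ℕ → ℕ → Carrier
      term l m = Li/u k m * transformTerm n (signedCoefficient exp-1 (suc m)) l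

      summand : ℕ → ℕ → Carrier
      summand l m = fromℕ (m !) * (- 1#) ^ (l ∸ m ∸ 1) * ƛ ^ (n ∸ l)
                      * S₂ l (suc m) * S₁ n l * powerInverse (suc m) (k ℤ.- + 1)

    ƛ*-1/ƛ≈-1 : ƛ * - 1/ƛ ≈ - 1#
    ƛ*-1/ƛ≈-1 = trans (sym (-‿distribʳ-* ƛ 1/ƛ)) (-‿cong (inverse-inverseʳ ƛ ƛ#0))

    -- The factor (1 + ƛ t)^(x/ƛ) is 1 at x = 0 and 1 - u at x = -1, so the difference leaves the
    -- factor u.
    polyBernoulli-difference :
      polyBernoulliNumber k ƛ ƛ#0 n - polyBernoulliPolynomial k ƛ ƛ#0 n (- 1#) ≈ fromℕ (n !) * (A S.* u) n
    polyBernoulli-difference = begin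
      fromℕ (n !) * (A S.* binomialSeries ƛ (0# * 1/ƛ)) n - fromℕ (n !) * (A S.* binomialSeries ƛ (- 1# * 1/ƛ)) n
        ≈⟨ x[y-z]≈xy-xz _ _ _ ⟨
      fromℕ (n !) * ((A S.* binomialSeries ƛ (0# * 1/ƛ)) n - (A S.* binomialSeries ƛ (- 1# * 1/ƛ)) n)
        ≈⟨ *-congˡ (+-cong (S*-cong {A} (λ _ → refl) (binomialSeries-zero ƛ (zeroˡ 1/ƛ)) n)
             (-‿cong (S*-cong {A} (λ _ → refl) (binomialSeries-cong ƛ (-1*x≈-x 1/ƛ)) n))) ⟩
      fromℕ (n !) * ((A S.* S.1#) n - (A S.* binomialSeries ƛ (- 1/ƛ)) n)
        ≈⟨ *-congˡ (trans (S*-distribˡ A S.1# (S.- binomialSeries ƛ (- 1/ƛ)) n)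
             (+-congˡ (S*-negʳ A (binomialSeries ƛ (- 1/ƛ)) n))) ⟨
      fromℕ (n !) * (A S.* u) n ∎

    term-vanishes : ∀ {l m} → l ≤ m → term l m ≈ 0#
    term-vanishes {l} {m} l≤m =
      y≈0⇒x*y≈0 (Li/u k m) (y≈0⇒x*y≈0 (degenerateS₁ ƛ n l)
        (y≈0⇒x*y≈0 ((- 1#) ^ l * (- 1#) ^ suc m) (y≈0⇒x*y≈0 (fromℕ (l !)) (^-order exp-1-zero (suc m) (s≤s l≤m)))))

    coefficient-expansion : ∀ m → Li/u k m * (fromℕ (n !) * (u S.^ suc m) n) ≈ ∑[ i < n ] term (suc (toℕ i)) m
    coefficient-expansion m = begin
      Li/u k m * (fromℕ (n !) * (u S.^ suc m) n)
        ≈⟨ *-congˡ (power-coefficient ƛ exp-1 u exp-1-zero (1-binomialSeries-zero ƛ (- 1/ƛ))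
             δ-exp-1 (δ-1-binomialSeries ƛ*-1/ƛ≈-1) n (suc m)) ⟩
      Li/u k m * transform n (signedCoefficient exp-1 (suc m))
        ≈⟨ *-distribˡ-sum {suc n} (Li/u k m) (λ l → transformTerm n (signedCoefficient exp-1 (suc m)) (toℕ l)) ⟩
      term 0 m + ∑[ i < n ] term (suc (toℕ i)) m
        -- The term l = 0 drops out because a positive power of e^t - 1 has no constant term; hence
        -- l = i + 1.
        ≈⟨ trans (+-congʳ (term-vanishes {0} {m} z≤n)) (+-identityˡ _) ⟩
      ∑[ i < n ] term (suc (toℕ i)) m ∎

    term≈summand : ∀ {l m} → m < l → term l m ≈ summand l m
    term≈summand {l} {m} m<l = begin
      a * (q * s₁ * ((- 1#) ^ l * (- 1#) ^ suc m * (f * e)))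
        ≈⟨ *-congˡ (*-congˡ (*-congʳ sign)) ⟩
      a * (q * s₁ * (σ * (f * e)))
        -- The 1 is inserted to be written as m! (m + 1) / (m + 1)!. Then 1/(m + 1)! completes
        -- `S₂ l (suc m)`, the factor m + 1 lowers k to k - 1, and m! stays.
        ≈⟨ *-identityˡ _ ⟨
      1# * (a * (q * s₁ * (σ * (f * e))))
        ≈⟨ *-congʳ (trans (*-congˡ (factorialInverse-suc m)) (factorialInverse-inverseʳ m)) ⟨
      fromℕ (m !) * (fromℕ (suc m) * factorialInverse (suc m)) * (a * (q * s₁ * (σ * (f * e))))
        ≈⟨ solve 9 (λ g s i a q s₁ σ f e → g :* (s :* i) :* (a :* (q :* s₁ :* (σ :* (f :* e))))
                      := g :* σ :* q :* (f :* (e :* i)) :* s₁ :* (s :* a)) refl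
             (fromℕ (m !)) (fromℕ (suc m)) (factorialInverse (suc m)) a q s₁ σ f e ⟩
      fromℕ (m !) * σ * q * S₂ l (suc m) * s₁ * (fromℕ (suc m) * a)
        ≈⟨ *-congˡ (powerInverse-pred m k) ⟨
      summand l m ∎
      where
      a q s₁ σ f e : Carrier
      a = Li/u k m
      q = ƛ ^ (n ∸ l)
      s₁ = S₁ n l
      σ = (- 1#) ^ (l ∸ m ∸ 1)
      f = fromℕ (l !)
      e = (exp-1 S.^ suc m) l

      sign : (- 1#) ^ l * (- 1#) ^ suc m ≈ σ
      sign = trans ([-1]^-∸ m<l) (reflexive (≡.cong ((- 1#) ^_)
        (≡.trans (≡.cong (l ∸_) (ℕ.+-comm 1 m)) (≡.sym (ℕ.∸-+-assoc l m 1)))))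

    polyBernoulli-difference-expansion :
      polyBernoulliNumber k ƛ ƛ#0 n - polyBernoulliPolynomial k ƛ ƛ#0 n (- 1#)
        ≈ ∑[ i < n ] ∑[ j < suc (toℕ i) ] summand (suc (toℕ i)) (toℕ j)
    polyBernoulli-difference-expansion = begin
      polyBernoulliNumber k ƛ ƛ#0 n - polyBernoulliPolynomial k ƛ ƛ#0 n (- 1#)
        ≈⟨ polyBernoulli-difference ⟩
      fromℕ (n !) * (A S.* u) n
        ≈⟨ *-congˡ (substitute-* (Li/u k) u (1-binomialSeries-zero ƛ (- 1/ƛ)) n) ⟩
      fromℕ (n !) * ∑[ m < n ] (Li/u k (toℕ m) * (u S.^ suc (toℕ m)) n)
        ≈⟨ *-distribˡ-sum {n} (fromℕ (n !)) (λ m → Li/u k (toℕ m) * (u S.^ suc (toℕ m)) n) ⟩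
      ∑[ m < n ] (fromℕ (n !) * (Li/u k (toℕ m) * (u S.^ suc (toℕ m)) n))
        ≈⟨ sum-cong-≋ {n} {λ m → fromℕ (n !) * (Li/u k (toℕ m) * (u S.^ suc (toℕ m)) n)}
             {λ m → ∑[ i < n ] term (suc (toℕ i)) (toℕ m)}
             (λ m → trans (solve 3 (λ x y z → x :* (y :* z) := y :* (x :* z)) refl
                       (fromℕ (n !)) (Li/u k (toℕ m)) ((u S.^ suc (toℕ m)) n))
                     (coefficient-expansion (toℕ m))) ⟩
      ∑[ m < n ] ∑[ i < n ] term (suc (toℕ i)) (toℕ m)
        -- The exchange is made on the full square; the triangle m < l is cut out afterwards, the
        -- terms with l ≤ m being 0 since (e^t - 1)^(m+1) has order above l.
        ≈⟨ ∑-comm {n} {n} (λ m i → term (suc (toℕ i)) (toℕ m)) ⟩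
      ∑[ i < n ] ∑[ m < n ] term (suc (toℕ i)) (toℕ m)
        ≈⟨ sum-cong-≋ {n} {λ i → ∑[ m < n ] term (suc (toℕ i)) (toℕ m)}
             {λ i → ∑[ j < suc (toℕ i) ] summand (suc (toℕ i)) (toℕ j)} truncate ⟩
      ∑[ i < n ] ∑[ j < suc (toℕ i) ] summand (suc (toℕ i)) (toℕ j) ∎
      where
      truncate : ∀ (i : Fin n) → ∑[ m < n ] term (suc (toℕ i)) (toℕ m)
               ≈ ∑[ j < suc (toℕ i) ] summand (suc (toℕ i)) (toℕ j)
      truncate i = begin
        ∑[ m < n ] term l (toℕ m)
          ≈⟨ sum-extend (term l) (toℕ<n i) (λ m l≤m → term-vanishes l≤m) ⟨
        ∑[ j < l ] term l (toℕ j)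
          ≈⟨ sum-cong-≋ {l} {λ j → term l (toℕ j)} {λ j → summand l (toℕ j)} (λ j → term≈summand (toℕ<n j)) ⟩
        ∑[ j < l ] summand l (toℕ j) ∎
        where
        l = suc (toℕ i)

theorem2 :
    ∀ {c ℓ₁ ℓ₂} (K : HeytingField c ℓ₁ ℓ₂) (char0 : CharacteristicZero K) →
    let open HeytingField K
        open CharZeroField K char0
    in
    (k : ℤ) (n : ℕ) → 1 ≤ n → (ƛ : Carrier) (ƛ#0 : ƛ # 0#) →
    polyBernoulliNumber k ƛ ƛ#0 n - polyBernoulliPolynomial k ƛ ƛ#0 n (- 1#)
      ≈ ∑[ i < n ] (let l = suc (toℕ i) in
          ∑[ j < l ] (let m = toℕ j in
            fromℕ (m !) * (- 1#) ^ (l ∸ m ∸ 1) * ƛ ^ (n ∸ l)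
              * S₂ l (suc m) * S₁ n l * powerInverse (suc m) (k ℤ.- + 1)))
theorem2 K char0 k n _ ƛ ƛ#0 = PolyBernoulli.polyBernoulli-difference-expansion K char0 k ƛ ƛ#0 n
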